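{- $[\mathcal{R}\mathbf{Txt}\mathbf{Td}\mathbf{CInd}\mathbf{Ex}_C]_{\mathbf{REC}} \setminus [\tau(\mathbf{CInd})\mathbf{Txt}\mathbf{G}\mathbf{Bc}_C]_{\mathbf{REC}} \neq \emptyset$.
   Context: Fix an acceptable numbering $(\varphi_e)_{e\in\mathbb{N}}$ of all partial computable functions. A number $e$ is a $C$-index if $\varphi_e$ is total with values in $\{0,1\}$; then $C_e=\{x:\varphi_e(x)=1\}$. $\mathbf{REC}$ is the collection of recursive subsets of $\mathbb{N}$; $\mathcal{P}$ and $\mathcal{R}$ are the partial computable and total computable functions. Fix a pause symbol $\#$. A text is a total function $T:\mathbb{N}\to\mathbb{N}\cup\{\#\}$, $\mathrm{content}(T)=\mathrm{range}(T)\setminus\{\#\}$, $T$ is a text for $L$ if $\mathrm{content}(T)=L$, $T[n]=(T(0),\dots,T(n-1))$. A learner is some $h\in\mathcal{P}$, which may output a special symbol "?" meaning "no new hypothesis". Hypothesis sequences: full-information $\mathbf{G}(h,T)(i)=h(T[i])$; transductive $\mathbf{Td}(h,T)(0)=?$, and for $i>0$, $\mathbf{Td}(h,T)(i)=\mathbf{Td}(h,T)(i-1)$ if $h(T(i-1))=?$, else $h(T(i-1))$. Restrictions on hypothesis sequence $p$ and text $T$: $\mathbf{Ex}_C$: there is $n_0$ with $p(n)=p(n_0)$ for all $n\ge n_0$ and $p(n_0)$ a $C$-index with $C_{p(n_0)}=\mathrm{content}(T)$; $\mathbf{Bc}_C$: there is $n_0$ such that for all $n\ge n_0$, $p(n)$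 is a $C$-index with $C_{p(n)}=\mathrm{content}(T)$; $\mathbf{CInd}$: for all $i$, $p(i)$ is a $C$-index. Juxtaposition means conjunction. For $\mathcal{C}\in\{\mathcal{P},\mathcal{R}\}$ (omitted means $\mathcal{P}$), $h\in\mathcal{C}$ $\tau(\alpha)\mathcal{C}\mathbf{Txt}\beta\delta$-learns $L$ iff $\alpha(\beta(h,T),T)$ holds for every text $T$ whatsoever (not only texts for $L$) and $\delta(\beta(h,T),T)$ holds for every text $T$ for $L$ (omitting $\tau(\alpha)$ means no such global requirement). $[\tau(\alpha)\mathcal{C}\mathbf{Txt}\beta\delta]_{\mathbf{REC}}$ is the set of all classes $\mathcal{L}\subseteq\mathbf{REC}$ for which some $h\in\mathcal{C}$ learns every $L\in\mathcal{L}$ in this sense. -}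

module Defs where

open import Data.Nat using (ℕ; zero; suc; _+_; _*_; _<_; _≤_)
open import Data.Maybe using (Maybe; just; nothing)
open import Data.Product using (Σ; ∃; ∃-syntax; _×_; _,_)
open import Data.Sum using (_⊎_)
open import Relation.Binary.PropositionalEquality using (_≡_)
open import Relation.Nullary using (¬_)
open import Function.Bundles using (_⇔_)

-- Cantor pairing  ⟨x,y⟩ = (x+y)(x+y+1)/2 + y

tri : ℕ → ℕ
tri zero    = zero
tri (suc n) = suc n + tri n

pair : ℕ → ℕ → ℕ
pair x y = tri (x + y) + y

-- A standard model of the partial computable functions:
-- unary μ-recursive programs over ℕ (with Cantor pairing).

data Code : Set where
  zeroC succC idC fstC sndC : Code
  compC  : Code → Code → Code
  pairC  : Code → Code → Code
  precC  : Code → Code → Code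
  muC    : Code → Code

data Eval : Code → ℕ → ℕ → Set where
  eZero : ∀ {x} → Eval zeroC x 0
  eSucc : ∀ {x} → Eval succC x (suc x)
  eId   : ∀ {x} → Eval idC x x
  eFst  : ∀ {a b} → Eval fstC (pair a b) a
  eSnd  : ∀ {a b} → Eval sndC (pair a b) b
  eComp : ∀ {f g x y z} → Eval g x y → Eval f y z → Eval (compC f g) x z
  ePair : ∀ {f g x a b} → Eval f x a → Eval g x b → Eval (pairC f g) x (pair a b)
  ePrec0 : ∀ {f g x y} → Eval f x y → Eval (precC f g) (pair x 0) y
  ePrecS : ∀ {f g x n r y} → Eval (precC f g) (pair x n) r →
           Eval g (pair x (pair n r)) y → Eval (precC f g) (pair x (suc n)) y
  eMu   : ∀ {f x n} → Eval f (pair x n) 0 →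
          (∀ m → m < n → ∃[ k ] Eval f (pair x m) (suc k)) → Eval (muC f) x n

-- Gödel numbering of programs (injective, computable, decidable range).
codeOf : Code → ℕ
codeOf zeroC       = 0
codeOf succC       = 1
codeOf idC         = 2
codeOf fstC        = 3
codeOf sndC        = 4
codeOf (compC f g) = 5 + 4 * pair (codeOf f) (codeOf g)
codeOf (pairC f g) = 6 + 4 * pair (codeOf f) (codeOf g)
codeOf (precC f g) = 7 + 4 * pair (codeOf f) (codeOf g)
codeOf (muC f)     = 8 + 4 * codeOf f

-- The fixed acceptable numbering: φ e x y  means  φ_e(x)↓ = y.
-- Numbers that are not codes denote the everywhere-undefined function.
φ : ℕ → ℕ → ℕ → Set
φ e x y = Σ Code λ c → codeOf c ≡ e × Eval c x y

Total : ℕ → Set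
Total e = ∀ x → ∃[ y ] φ e x y

Lang : Set₁
Lang = ℕ → Set

CIndex : ℕ → Set
CIndex e = ∀ x → ∃[ y ] (φ e x y × (y ≡ 0 ⊎ y ≡ 1))

C : ℕ → Lang
C e x = φ e x 1

SameLang : Lang → Lang → Set
SameLang L M = ∀ x → L x ⇔ M x

REC : Lang → Set
REC L = ∃[ e ] (CIndex e × SameLang (C e) L)

-- Texts ( nothing = the pause symbol # )

Text : Set
Text = ℕ → Maybe ℕ

content : Text → Lang
content T x = ∃[ n ] T n ≡ just x

TextFor : Text → Lang → Set
TextFor T L = SameLang (content T) L

encElem : Maybe ℕ → ℕ
encElem nothing  = 0
encElem (just x) = suc x

encPrefix : Text → ℕ → ℕ
encPrefix T zero    = 0
encPrefix T (suc n) = suc (pair (encPrefix T n) (encElem (T n)))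

-- Hypothesis sequences, as (partial) relations:  p i v  means  p(i)↓ = v,
-- where v = nothing stands for "?" and v = just e for hypothesis e.
-- A learner's output o is decoded as:  0 ↦ ?,  e+1 ↦ e.

HypSeq : Set₁
HypSeq = ℕ → Maybe ℕ → Set

Outputs : ℕ → ℕ → Maybe ℕ → Set
Outputs h n nothing  = φ h n 0
Outputs h n (just e) = φ h n (suc e)

G : ℕ → Text → HypSeq
G h T i v = Outputs h (encPrefix T i) v

data Td (h : ℕ) (T : Text) : HypSeq where
  td0 : Td h T 0 nothing
  tdQ : ∀ {i v} → Td h T i v → φ h (encElem (T i)) 0 → Td h T (suc i) v
  tdH : ∀ {i e} → φ h (encElem (T i)) (suc e) → Td h T (suc i) (just e)

Ex-C : HypSeq → Text → Set
Ex-C p T = ∃[ n₀ ] ∃[ e ] ((∀ n → n₀ ≤ n → p n (just e)) ×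
                           CIndex e × SameLang (C e) (content T))

Bc-C : HypSeq → Text → Set
Bc-C p T = ∃[ n₀ ] (∀ n → n₀ ≤ n → ∃[ e ] (p n (just e) × CIndex e ×
                                           SameLang (C e) (content T)))

-- every hypothesis is a C-index ("?" is not a hypothesis, hence allowed;
-- an undefined value is not allowed)
CInd : HypSeq → Text → Set
CInd p T = ∀ i → p i nothing ⊎ ∃[ e ] (p i (just e) × CIndex e)

-- 𝓛 ∈ [𝓡 Txt Td CInd Ex_C]_REC  (membership of 𝓛 ⊆ REC stated separately)
RTxtTdCIndExC : (Lang → Set) → Set₁
RTxtTdCIndExC 𝓛 = ∃[ h ] (Total h × (∀ L → 𝓛 L → ∀ T → TextFor T L →
                           CInd (Td h T) T × Ex-C (Td h T) T))

τCIndTxtGBcC : (Lang → Set) → Set₁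
τCIndTxtGBcC 𝓛 = ∃[ h ] ((∀ T → CInd (G h T) T) ×
                         (∀ L → 𝓛 L → ∀ T → TextFor T L → Bc-C (G h T) T))

{-# OPTIONS --safe #-}
module Submission where

-- The class consists of the nonempty L all of whose elements ⟨e,n⟩ carry one and the same C-index e
-- of L; a transductive learner just outputs the first component of the current datum.
--
-- If all hypotheses of h on all texts are C-indices, then uniformly in e there is a computable text
-- T with T(0) = ⟨e,0⟩ and, for n > 0, T(n) = # or T(n) = ⟨e,n⟩ according to whether the hypothesis
-- h(T[n]) contains ⟨e,n⟩ or not.  Its content is decidable, because ⟨e,n⟩ can only occur at
-- position n.  By the recursion theorem e can be chosen to be a C-index of this content, which is
-- then in the class, although h is wrong about ⟨e,n⟩ at every n > 0.
--
-- Evaluating the hypotheses of h inside a program needs a universal program.  It is enough to know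
-- that it follows every terminating computation, and then φ is single-valued because Eval is: the
-- injectivity of the Gödel numbering is never needed.

open import Defs
open import Data.Empty using (⊥; ⊥-elim)
open import Data.List using (List; []; _∷_)
open import Data.Maybe using (Maybe; just; nothing)
open import Data.Nat
open import Data.Nat.Induction using (<-rec)
open import Data.Nat.Properties
open import Data.Product using (Σ; ∃-syntax; _×_; _,_; proj₁; proj₂)
open import Data.Sum using (_⊎_; inj₁; inj₂)
open import Function.Bundles using (mk⇔; module Equivalence)
open import Relation.Binary.Definitions using (tri<; tri≈; tri>)
open import Relation.Binary.PropositionalEquality
open import Relation.Nullary using (¬_; yes; no)

open Equivalence using (to; from)

-- Cantor pairing

pair-diagonal : ∀ a b → pair a (suc b) ≡ suc (pair (suc a) b)
pair-diagonal a b = trans (+-suc _ b) (cong (λ k → suc (tri k + b)) (+-suc a b))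

pair-axis : ∀ a → pair (suc a) 0 ≡ suc (pair 0 a)
pair-axis a rewrite +-identityʳ a | +-identityʳ (a + tri a) = cong suc (+-comm a (tri a))

-- The order in which `pair` numbers the points: down an antidiagonal with growing second component,
-- then on to the start of the next one.
next : ℕ × ℕ → ℕ × ℕ
next (zero  , b) = suc b , 0
next (suc a , b) = a , suc b

unpair : ℕ → ℕ × ℕ
unpair zero    = 0 , 0
unpair (suc n) = next (unpair n)

pair-next : ∀ p → pair (proj₁ (next p)) (proj₂ (next p)) ≡ suc (pair (proj₁ p) (proj₂ p))
pair-next (zero  , b) = pair-axis b
pair-next (suc a , b) = pair-diagonal a b

pair-unpair : ∀ n → pair (proj₁ (unpair n)) (proj₂ (unpair n)) ≡ n
pair-unpair zero    = refl
pair-unpair (suc n) = trans (pair-next (unpair n)) (cong suc (pair-unpair n))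

-- Induction on the antidiagonal and, along it, on b; only a point with b = 0 has its predecessor on
-- the previous antidiagonal.
unpair-pair : ∀ a b → unpair (pair a b) ≡ (a , b)
unpair-pair a b = go (a + b) b a refl
  where
  go : ∀ s b a → a + b ≡ s → unpair (pair a b) ≡ (a , b)
  go s (suc b) a eq = trans (cong unpair (pair-diagonal a b))
    (cong next (go s b (suc a) (trans (sym (+-suc a b)) eq)))
  go zero zero zero eq = refl
  go (suc s) zero (suc a) eq = trans (cong unpair (pair-axis a))
    (cong next (go s a 0 (trans (sym (+-identityʳ a)) (suc-injective eq))))

opaque
  π₁ π₂ : ℕ → ℕ
  π₁ n = proj₁ (unpair n)
  π₂ n = proj₂ (unpair n)

  pair-π : ∀ n → pair (π₁ n) (π₂ n) ≡ n
  pair-π = pair-unpair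

  π₁-pair : ∀ a b → π₁ (pair a b) ≡ a
  π₁-pair a b = cong proj₁ (unpair-pair a b)

  π₂-pair : ∀ a b → π₂ (pair a b) ≡ b
  π₂-pair a b = cong proj₂ (unpair-pair a b)

π₁-cong : ∀ {n} a b → pair a b ≡ n → π₁ n ≡ a
π₁-cong a b refl = π₁-pair a b

π₂-cong : ∀ {n} a b → pair a b ≡ n → π₂ n ≡ b
π₂-cong a b refl = π₂-pair a b

pair-injective : ∀ a b c d → pair a b ≡ pair c d → a ≡ c × b ≡ d
pair-injective a b c d eq =
  trans (sym (π₁-cong a b eq)) (π₁-pair c d) , trans (sym (π₂-cong a b eq)) (π₂-pair c d)

-- The inputs are related by an equation because `pair` is not a constructor: inputs of the form
-- `pair a b` are compared through `pair-injective`, not by unification.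
Eval-functional : ∀ {c x x′ y z} → Eval c x y → Eval c x′ z → x ≡ x′ → y ≡ z
Eval-functional eZero eZero _ = refl
Eval-functional eSucc eSucc p = cong suc p
Eval-functional eId eId p = p
Eval-functional (eFst {a} {b}) (eFst {c} {d}) p = proj₁ (pair-injective a b c d p)
Eval-functional (eSnd {a} {b}) (eSnd {c} {d}) p = proj₂ (pair-injective a b c d p)
Eval-functional (eComp d₁ d₂) (eComp d₁′ d₂′) p =
  Eval-functional d₂ d₂′ (Eval-functional d₁ d₁′ p)
Eval-functional (ePair d₁ d₂) (ePair d₁′ d₂′) p =
  cong₂ pair (Eval-functional d₁ d₁′ p) (Eval-functional d₂ d₂′ p)
Eval-functional (ePrec0 {x = x} d) (ePrec0 {x = x′} d′) p =
  Eval-functional d d′ (proj₁ (pair-injective x 0 x′ 0 p))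
Eval-functional (ePrec0 {x = x} _) (ePrecS {x = x′} {n = n} _ _) p
  with () ← proj₂ (pair-injective x 0 x′ (suc n) p)
Eval-functional (ePrecS {x = x} {n = n} _ _) (ePrec0 {x = x′} _) p
  with () ← proj₂ (pair-injective x (suc n) x′ 0 p)
Eval-functional (ePrecS {x = x} {n = n} d₁ d₂) (ePrecS {x = x′} {n = n′} d₁′ d₂′) p
  with refl , refl ← pair-injective x (suc n) x′ (suc n′) p =
  Eval-functional d₂ d₂′ (cong (λ r → pair x (pair n r)) (Eval-functional d₁ d₁′ refl))
-- If the minima differ, the body yields 0 at the smaller one, while minimality of the larger one
-- demands a successor there.
Eval-functional (eMu {n = n} d below) (eMu {n = n′} d′ below′) p with <-cmp n n′
... | tri≈ _ n≡n′ _ = n≡n′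
... | tri< n<n′ _ _
  with () ← Eval-functional d (proj₂ (below′ n n<n′)) (cong (λ x → pair x n) p)
... | tri> _ _ n′<n
  with () ← Eval-functional (proj₂ (below n′ n′<n)) d′ (cong (λ x → pair x n′) p)

-- Total functions with programs

record Fun : Set where
  constructor fun
  field
    ⟦_⟧  : ℕ → ℕ
    code : Code
    eval : ∀ x → Eval code x (⟦_⟧ x)

open Fun

ifz : ℕ → ℕ → ℕ → ℕ
ifz zero    a b = a
ifz (suc _) a b = b

iter : (ℕ → ℕ) → ℕ → ℕ → ℕ
iter f a zero    = a
iter f a (suc n) = f (iter f a n)

rec : (ℕ → ℕ) → (ℕ → ℕ) → ℕ → ℕ → ℕ
rec f g a zero    = f a
rec f g a (suc n) = g (pair a (pair n (rec f g a n)))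

eval-fst : ∀ n → Eval fstC n (π₁ n)
eval-fst n = subst (λ m → Eval fstC m (π₁ n)) (pair-π n) (eFst {π₁ n} {π₂ n})

eval-snd : ∀ n → Eval sndC n (π₂ n)
eval-snd n = subst (λ m → Eval sndC m (π₂ n)) (pair-π n) (eSnd {π₁ n} {π₂ n})

idF zeroF : Fun
idF   = fun (λ x → x) idC (λ _ → eId)
zeroF = fun (λ _ → 0) zeroC (λ _ → eZero)

infixr 9 _∘F_
_∘F_ : Fun → Fun → Fun
f ∘F g = fun (λ x → ⟦ f ⟧ (⟦ g ⟧ x)) (compC (code f) (code g))
             (λ x → eComp (eval g x) (eval f _))

sucF fstF sndF : Fun → Fun
sucF f = fun suc succC (λ _ → eSucc) ∘F f
fstF f = fun π₁ fstC eval-fst ∘F f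
sndF f = fun π₂ sndC eval-snd ∘F f

⟨_,_⟩ : Fun → Fun → Fun
⟨ f , g ⟩ = fun (λ x → pair (⟦ f ⟧ x) (⟦ g ⟧ x)) (pairC (code f) (code g))
                (λ x → ePair (eval f x) (eval g x))

recF : Fun → Fun → Fun → Fun
recF n f g = fun (λ x → rec ⟦ f ⟧ ⟦ g ⟧ x (⟦ n ⟧ x))
  (compC (precC (code f) (code g)) (pairC idC (code n)))
  (λ x → eComp (ePair eId (eval n x)) (go x (⟦ n ⟧ x)))
  where
  go : ∀ x k → Eval (precC (code f) (code g)) (pair x k) (rec ⟦ f ⟧ ⟦ g ⟧ x k)
  go x zero    = ePrec0 {x = x} (eval f x)
  go x (suc k) = ePrecS {x = x} {n = k} (go x k) (eval g _)

iterF : Fun → Fun → Fun → Fun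
iterF g f n = fun (λ x → iter ⟦ g ⟧ (⟦ f ⟧ x) (⟦ n ⟧ x))
  (code (recF n f (g ∘F sndF (sndF idF))))
  (λ x → subst (Eval _ x) (go x (⟦ n ⟧ x)) (eval (recF n f (g ∘F sndF (sndF idF))) x))
  where
  go : ∀ x k → rec ⟦ f ⟧ (λ s → ⟦ g ⟧ (π₂ (π₂ s))) x k ≡ iter ⟦ g ⟧ (⟦ f ⟧ x) k
  go x zero    = refl
  go x (suc k) = cong ⟦ g ⟧ (trans (cong π₂ (π₂-pair x _)) (trans (π₂-pair k _) (go x k)))

predF : Fun → Fun
predF n = fun (λ x → pred (⟦ n ⟧ x)) (code (recF n zeroF (fstF (sndF idF))))
  (λ x → subst (Eval _ x) (go x (⟦ n ⟧ x)) (eval (recF n zeroF (fstF (sndF idF))) x))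
  where
  go : ∀ x k → rec (λ _ → 0) (λ s → π₁ (π₂ s)) x k ≡ pred k
  go x zero    = refl
  go x (suc k) = trans (cong π₁ (π₂-pair x _)) (π₁-pair k _)

ifzF : Fun → Fun → Fun → Fun
ifzF n f g = fun (λ x → ifz (⟦ n ⟧ x) (⟦ f ⟧ x) (⟦ g ⟧ x)) (code (recF n f (g ∘F fstF idF)))
  (λ x → subst (Eval _ x) (go x (⟦ n ⟧ x)) (eval (recF n f (g ∘F fstF idF)) x))
  where
  go : ∀ x k → rec ⟦ f ⟧ (λ s → ⟦ g ⟧ (π₁ s)) x k ≡ ifz k (⟦ f ⟧ x) (⟦ g ⟧ x)
  go x zero    = refl
  go x (suc k) = cong ⟦ g ⟧ (π₁-pair x _)

monusF : Fun → Fun → Fun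
monusF f g = fun (λ x → ⟦ f ⟧ x ∸ ⟦ g ⟧ x) (code (iterF (predF idF) f g))
  (λ x → subst (Eval _ x) (go (⟦ f ⟧ x) (⟦ g ⟧ x)) (eval (iterF (predF idF) f g) x))
  where
  go : ∀ a b → iter pred a b ≡ a ∸ b
  go a zero    = refl
  go a (suc b) = trans (cong pred (go a b)) (pred[m∸n]≡m∸[1+n] a b)

switchF : Fun → List Fun → Fun
switchF n []       = zeroF
switchF n (f ∷ fs) = ifzF n f (switchF (predF n) fs)

numeral : ℕ → Code
numeral zero    = zeroC
numeral (suc n) = compC succC (numeral n)

numF : ℕ → Fun
numF n = fun (λ _ → n) (numeral n) (go n)
  where
  go : ∀ n x → Eval (numeral n) x n
  go zero    x = eZero
  go (suc n) x = eComp (go n x) eSucc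

-- The universal program

-- The pairs of the machine below are opaque: unfolding tri at numerals would blow up the goals.
opaque
  cell : ℕ → ℕ → ℕ
  cell = pair

  eval-cell : ∀ {f g x a b} → Eval f x a → Eval g x b → Eval (pairC f g) x (cell a b)
  eval-cell = ePair

  π₁-cell : ∀ a b → π₁ (cell a b) ≡ a
  π₁-cell = π₁-pair

  π₂-cell : ∀ a b → π₂ (cell a b) ≡ b
  π₂-cell = π₂-pair

cellF : Fun → Fun → Fun
cellF f g = fun (λ x → cell (⟦ f ⟧ x) (⟦ g ⟧ x)) (pairC (code f) (code g))
                (λ x → eval-cell (eval f x) (eval g x))

opaque
  -- dec e reads off the tag and the data of the Gödel number e by counting up to e: the tags run
  -- through 0, …, 4 and then cyclically through 5, …, 8, with the data increasing at each wrap.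
  nextTagF : Fun
  nextTagF = ifzF (monusF (numF 8) (fstF idF)) (cellF (numF 5) (sucF (sndF idF)))
                                              (cellF (sucF (fstF idF)) (sndF idF))

  nextTag-eq : ∀ t q → ⟦ nextTagF ⟧ (cell t q) ≡ ifz (8 ∸ t) (cell 5 (suc q)) (cell (suc t) q)
  nextTag-eq t q rewrite π₁-cell t q | π₂-cell t q = refl

decF : Fun → Fun
decF = iterF nextTagF (cellF zeroF zeroF)

dec : ℕ → ℕ
dec = iter ⟦ nextTagF ⟧ (cell 0 0)

dec-suc : ∀ {n} t q → dec n ≡ cell t q →
          dec (suc n) ≡ ifz (8 ∸ t) (cell 5 (suc q)) (cell (suc t) q)
dec-suc t q eq = trans (cong ⟦ nextTagF ⟧ eq) (nextTag-eq t q)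

dec-1 : dec 1 ≡ cell 1 0
dec-1 = dec-suc {0} 0 0 refl

dec-2 : dec 2 ≡ cell 2 0
dec-2 = dec-suc {1} 1 0 dec-1

dec-3 : dec 3 ≡ cell 3 0
dec-3 = dec-suc {2} 2 0 dec-2

dec-4 : dec 4 ≡ cell 4 0
dec-4 = dec-suc {3} 3 0 dec-3

dec-5 : ∀ q → dec (5 + 4 * q) ≡ cell 5 q
dec-6 : ∀ q → dec (6 + 4 * q) ≡ cell 6 q
dec-7 : ∀ q → dec (7 + 4 * q) ≡ cell 7 q
dec-8 : ∀ q → dec (8 + 4 * q) ≡ cell 8 q
dec-5 zero    = dec-suc {4} 4 0 dec-4
dec-5 (suc q) = trans (cong (λ n → dec (5 + n)) (*-suc 4 q)) (dec-suc {8 + 4 * q} 8 q (dec-8 q))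
dec-6 q = dec-suc {5 + 4 * q} 5 q (dec-5 q)
dec-7 q = dec-suc {6 + 4 * q} 6 q (dec-6 q)
dec-8 q = dec-suc {7 + 4 * q} 7 q (dec-7 q)

-- A stack machine for the programs.  A state pairs a stack of tasks with the current value; a task
-- pairs a tag with its data.  Tags 0–8 are the constructors of Code, the others are continuations:
-- 9 evaluates the second component of a pair, 10 forms the pair, 11 is the step of a primitive
-- recursion, 12 tests the current candidate of a minimisation and 13 inspects the outcome.
push : ℕ → ℕ → ℕ
push t K = suc (cell t K)

pushF : Fun → Fun → Fun
pushF t K = sucF (cellF t K)

moveF : Fun → Fun → Fun → Fun → Fun
moveF t q K v = switchF t
  -- The entries follow the order of the tags; in each, the outermost push is the task that runs
  -- next.
  ( cellF K zeroF
  ∷ cellF K (sucF v)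
  ∷ cellF K v
  ∷ cellF K (fstF v)
  ∷ cellF K (sndF v)
  ∷ cellF (pushF (decF (sndF q)) (pushF (decF (fstF q)) K)) v
  ∷ cellF (pushF (decF (fstF q)) (pushF (cellF (numF 9) ⟨ sndF q , v ⟩) K)) v
  ∷ ifzF (sndF v)
      (cellF (pushF (decF (fstF q)) K) (fstF v))
      (cellF (pushF (cellF (numF 7) q) (pushF (cellF (numF 11) ⟨ sndF q , v⁻ ⟩) K)) v⁻)
  ∷ cellF (pushF (cellF (numF 12) q) K) ⟨ v , zeroF ⟩
  ∷ cellF (pushF (decF (fstF q)) (pushF (cellF (numF 10) v) K)) (sndF q)
  ∷ cellF K ⟨ q , v ⟩
  ∷ cellF (pushF (decF (fstF q)) K) ⟨ fstF (sndF q) , ⟨ sndF (sndF q) , v ⟩ ⟩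
  ∷ cellF (pushF (decF q) (pushF (cellF (numF 13) ⟨ q , v ⟩) K)) v
  ∷ ifzF v
      (cellF K (sndF (sndF q)))
      (cellF (pushF (cellF (numF 12) (fstF q)) K) ⟨ fstF (sndF q) , sucF (sndF (sndF q)) ⟩)
  ∷ [])
  where
  v⁻ = ⟨ fstF v , predF (sndF v) ⟩

stepF : Fun
stepF = moveF (fstF top) (sndF top) (sndF stack) (sndF idF)
  where
  stack = predF (fstF idF)
  top   = fstF stack

step : ℕ → ℕ
step = ⟦ stepF ⟧

-- Constants are fed to `moveF` so that the program and its specification share one table, which
-- reduces by computation at a literal tag.
move : ℕ → ℕ → ℕ → ℕ → ℕ
move t q K v = ⟦ moveF (numF t) (numF q) (numF K) (numF v) ⟧ 0

state : ℕ → ℕ → ℕ → ℕ → ℕ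
state t q K v = cell (push (cell t q) K) v

opaque
  step-state : ∀ t q K v → step (state t q K v) ≡ move t q K v
  step-state t q K v = cong₄ (trans (cong π₁ top) (π₁-cell t q)) (trans (cong π₂ top) (π₂-cell t q))
                             (trans (cong (λ s → π₂ (pred s)) stack) (π₂-cell (cell t q) K))
                             (π₂-cell (push (cell t q) K) v)
    where
    stack : π₁ (state t q K v) ≡ push (cell t q) K
    stack = π₁-cell (push (cell t q) K) v
    top : π₁ (pred (π₁ (state t q K v))) ≡ cell t q
    top = trans (cong (λ s → π₁ (pred s)) stack) (π₁-cell (cell t q) K)
    cong₄ : ∀ {t t′ q q′ K K′ v v′} → t ≡ t′ → q ≡ q′ → K ≡ K′ → v ≡ v′ →
            move t q K v ≡ move t′ q′ K′ v′
    cong₄ refl refl refl refl = refl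

data _⟶*_ : ℕ → ℕ → Set where
  done : ∀ {s} → s ⟶* s
  more : ∀ {s} t q K v → move t q K v ⟶* s → state t q K v ⟶* s

_++*_ : ∀ {s t u} → s ⟶* t → t ⟶* u → s ⟶* u
done           ++* r′ = r′
more t q K v r ++* r′ = more t q K v (r ++* r′)

_≡⟶*_ : ∀ {s t u} → s ≡ t → t ⟶* u → s ⟶* u
refl ≡⟶* r = r

infixr 5 _++*_ _≡⟶*_

opaque
  move-comp : ∀ f g K v → move 5 (pair f g) K v ≡ cell (push (dec g) (push (dec f) K)) v
  move-comp f g K v = cong₂ (λ f g → cell (push (dec g) (push (dec f) K)) v)
                            (π₁-pair f g) (π₂-pair f g)

  move-pair : ∀ f g K v →
    move 6 (pair f g) K v ≡ cell (push (dec f) (push (cell 9 (pair g v)) K)) v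
  move-pair f g K v = cong₂ (λ f g → cell (push (dec f) (push (cell 9 (pair g v)) K)) v)
                            (π₁-pair f g) (π₂-pair f g)

  move-prec-zero : ∀ f g K x → move 7 (pair f g) K (pair x 0) ≡ cell (push (dec f) K) x
  move-prec-zero f g K x rewrite π₂-pair x 0 =
    cong₂ (λ f x → cell (push (dec f) K) x) (π₁-pair f g) (π₁-pair x 0)

  move-prec-suc : ∀ f g K x n → move 7 (pair f g) K (pair x (suc n)) ≡
    state 7 (pair f g) (push (cell 11 (pair g (pair x n))) K) (pair x n)
  move-prec-suc f g K x n rewrite π₂-pair x (suc n) =
    cong₂ (λ g x → state 7 (pair f _) (push (cell 11 (pair g (pair x n))) K) (pair x n))
          (π₂-pair f g) (π₁-pair x (suc n))

  move-second : ∀ g x K a → move 9 (pair g x) K a ≡ cell (push (dec g) (push (cell 10 a) K)) x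
  move-second g x K a = cong₂ (λ g x → cell (push (dec g) (push (cell 10 a) K)) x)
                              (π₁-pair g x) (π₂-pair g x)

  move-prec-step : ∀ g x n K r →
    move 11 (pair g (pair x n)) K r ≡ cell (push (dec g) K) (pair x (pair n r))
  move-prec-step g x n K r rewrite π₁-pair g (pair x n) | π₂-pair g (pair x n) =
    cong₂ (λ x n → cell (push (dec g) K) (pair x (pair n r))) (π₁-pair x n) (π₂-pair x n)

  move-found : ∀ f x n K → move 13 (pair f (pair x n)) K 0 ≡ cell K n
  move-found f x n K = cong (cell K) (trans (cong π₂ (π₂-pair f (pair x n))) (π₂-pair x n))

  move-continue : ∀ f x n K k →
    move 13 (pair f (pair x n)) K (suc k) ≡ state 12 f K (pair x (suc n))
  move-continue f x n K k rewrite π₁-pair f (pair x n) | π₂-pair f (pair x n) =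
    cong₂ (λ x n → state 12 f K (pair x (suc n))) (π₁-pair x n) (π₂-pair x n)

-- Simulation of evaluation by the machine

task : Code → ℕ → ℕ → ℕ
task c K v = cell (push (dec (codeOf c)) K) v

decode : ∀ c {t q K v s} → dec (codeOf c) ≡ cell t q → move t q K v ⟶* s → task c K v ⟶* s
decode c {t} {q} {K} {v} eq r = cong (λ e → cell (push e K) v) eq ≡⟶* more t q K v r

-- The remaining stack K is arbitrary so that the runs of subcomputations can be chained, each above
-- the continuation that awaits its value.
simulate : ∀ {c x y} → Eval c x y → ∀ K → task c K x ⟶* cell K y
simulate eZero K = decode zeroC {0} {0} refl done
simulate eSucc K = decode succC {1} {0} dec-1 done
simulate eId K = decode idC {2} {0} dec-2 done
simulate (eFst {a} {b}) K = decode fstC {3} {0} dec-3 (cong (cell K) (π₁-pair a b) ≡⟶* done)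
simulate (eSnd {a} {b}) K = decode sndC {4} {0} dec-4 (cong (cell K) (π₂-pair a b) ≡⟶* done)
simulate (eComp {f} {g} {x} d₁ d₂) K =
  decode (compC f g) (dec-5 (pair (codeOf f) (codeOf g)))
    (move-comp (codeOf f) (codeOf g) K x ≡⟶*
     simulate d₁ (push (dec (codeOf f)) K) ++* simulate d₂ K)
simulate (ePair {f} {g} {x} {a} {b} d₁ d₂) K =
  decode (pairC f g) (dec-6 (pair (codeOf f) (codeOf g)))
    (move-pair (codeOf f) (codeOf g) K x ≡⟶*
     simulate d₁ (push (cell 9 (pair (codeOf g) x)) K) ++*
     more 9 (pair (codeOf g) x) K a
       (move-second (codeOf g) x K a ≡⟶*
        simulate d₂ (push (cell 10 a) K) ++* more 10 a K b done))
simulate (ePrec0 {f} {g} {x} d) K =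
  decode (precC f g) (dec-7 (pair (codeOf f) (codeOf g)))
    (move-prec-zero (codeOf f) (codeOf g) K x ≡⟶* simulate d K)
simulate (ePrecS {f} {g} {x} {n} {r} d₁ d₂) K =
  decode (precC f g) (dec-7 (pair (codeOf f) (codeOf g)))
    (move-prec-suc (codeOf f) (codeOf g) K x n ≡⟶*
     -- The move pushes the recursion already decoded; undoing the decoding gives the task of the
     -- induction hypothesis.
     cong (λ e → cell (push e K′) (pair x n)) (sym (dec-7 (pair (codeOf f) (codeOf g)))) ≡⟶*
     simulate d₁ K′ ++*
     more 11 (pair (codeOf g) (pair x n)) K r
       (move-prec-step (codeOf g) x n K r ≡⟶* simulate d₂ K))
  where
  K′ = push (cell 11 (pair (codeOf g) (pair x n))) K
simulate (eMu {f} {x} {n} d below) K =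
  decode (muC f) (dec-8 (codeOf f)) (search n 0 (+-identityʳ n))
  where
  F = codeOf f
  -- m is the current candidate and j the number of candidates still to be rejected.
  search : ∀ j m → j + m ≡ n → state 12 F K (pair x m) ⟶* cell K n
  search zero m refl = more 12 F K (pair x m)
    (simulate d (push (cell 13 (pair F (pair x m))) K) ++*
     more 13 (pair F (pair x m)) K 0 (move-found F x m K ≡⟶* done))
  search (suc j) m eq = more 12 F K (pair x m)
    (simulate (proj₂ (below m m<n)) (push (cell 13 (pair F (pair x m))) K) ++*
     more 13 (pair F (pair x m)) K (suc k)
       (move-continue F x m K k ≡⟶* search j (suc m) (trans (+-suc j m) eq)))
    where
    m<n : m < n
    m<n = subst (m <_) eq (s≤s (m≤n+m m j))
    k = proj₁ (below m m<n)

-- Finding the end of a run by minimisation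

iter-shift : ∀ f s n → iter f (f s) n ≡ iter f s (suc n)
iter-shift f s zero    = refl
iter-shift f s (suc n) = cong f (iter-shift f s n)

-- `more` leaves only states with a nonempty stack, coded by a successor; this is what `eMu`
-- requires of all times before the halting time.
⟶*⇒iter : ∀ {s t} → s ⟶* t →
  ∃[ n ] (iter step s n ≡ t × (∀ m → m < n → ∃[ k ] π₁ (iter step s m) ≡ suc k))
⟶*⇒iter done = 0 , refl , λ _ ()
⟶*⇒iter {t = t} (more u q K v r) with ⟶*⇒iter r
... | n , reached , running = suc n , trans (shift n) reached , running′
  where
  shift : ∀ m → iter step (state u q K v) (suc m) ≡ iter step (move u q K v) m
  shift m = trans (sym (iter-shift step (state u q K v) m))
                  (cong (λ s → iter step s m) (step-state u q K v))
  running′ : ∀ m → m < suc n → ∃[ k ] π₁ (iter step (state u q K v) m) ≡ suc k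
  running′ zero    _         = cell (cell u q) K , π₁-cell _ v
  running′ (suc m) (s≤s m<n) = proj₁ (running m m<n) ,
                               trans (cong π₁ (shift m)) (proj₂ (running m m<n))

runF : Fun
runF = iterF stepF (fstF idF) (sndF idF)

run-iter : ∀ s n → ⟦ runF ⟧ (pair s n) ≡ iter step s n
run-iter s n = cong₂ (iter step) (π₁-pair s n) (π₂-pair s n)

opaque
  haltC : Code
  haltC = compC (code (sndF runF)) (pairC idC (muC (code (fstF runF))))

  halt : ∀ {s y} → s ⟶* cell 0 y → Eval haltC s y
  halt {s} {y} r with ⟶*⇒iter r
  ... | n , reached , running = eComp (ePair eId (eMu found searching))
    (subst (Eval _ (pair s n)) (trans (cong π₂ reached′) (π₂-cell 0 y)) (eval (sndF runF) (pair s n)))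
    where
    reached′ : ⟦ runF ⟧ (pair s n) ≡ cell 0 y
    reached′ = trans (run-iter s n) reached
    found : Eval (code (fstF runF)) (pair s n) 0
    found = subst (Eval _ (pair s n)) (trans (cong π₁ reached′) (π₁-cell 0 y))
                  (eval (fstF runF) (pair s n))
    searching : ∀ m → m < n → ∃[ k ] Eval (code (fstF runF)) (pair s m) (suc k)
    searching m m<n = proj₁ (running m m<n) ,
      subst (Eval _ (pair s m)) (trans (cong π₁ (run-iter s m)) (proj₂ (running m m<n)))
            (eval (fstF runF) (pair s m))

  initF : Fun
  initF = cellF (pushF (decF (fstF idF)) zeroF) (sndF idF)

  universal : Code
  universal = compC haltC (code initF)

  φ-universal : ∀ {e x y} → φ e x y → Eval universal (pair e x) y
  φ-universal {e} {x} {y} (c , refl , d) =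
    eComp (subst (Eval _ (pair e x))
                 (cong₂ (λ e x → cell (push (dec e) 0) x) (π₁-pair e x) (π₂-pair e x))
                 (eval initF (pair e x)))
          (halt (simulate d 0))

φ-functional : ∀ {e x y z} → φ e x y → φ e x z → y ≡ z
φ-functional p q = Eval-functional (φ-universal p) (φ-universal q) refl

index : ∀ (f : Fun) → ∃[ e ] (∀ x → φ e x (⟦ f ⟧ x))
index f = codeOf (code f) , λ x → code f , refl , eval f x

-- The recursion theorem

-- The s-m-n construction: n is hard-wired as the first component of the input.
specialise : Code → ℕ → Code
specialise c n = compC c (pairC (numeral n) idC)

plusF : ℕ → Fun → Fun
plusF zero    f = f
plusF (suc n) f = sucF (plusF n f)

quadrupleF : Fun → Fun
quadrupleF f = fun (λ x → 4 * ⟦ f ⟧ x) (code (iterF (plusF 4 idF) zeroF f))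
  (λ x → subst (Eval _ x) (go (⟦ f ⟧ x)) (eval (iterF (plusF 4 idF) zeroF f) x))
  where
  go : ∀ n → iter (4 +_) 0 n ≡ 4 * n
  go zero    = refl
  go (suc n) = trans (cong (4 +_) (go n)) (sym (*-suc 4 n))

codeOf-numeralF : Fun
codeOf-numeralF = fun (λ n → codeOf (numeral n)) (code (iterF sucC-numeralF zeroF idF))
  (λ n → subst (Eval _ n) (go n) (eval (iterF sucC-numeralF zeroF idF) n))
  where
  sucC-numeralF : Fun
  -- 5 is the tag of `compC` and 1 the number of `succC`.
  sucC-numeralF = plusF 5 (quadrupleF ⟨ numF 1 , idF ⟩)
  go : ∀ n → iter ⟦ sucC-numeralF ⟧ 0 n ≡ codeOf (numeral n)
  go zero    = refl
  go (suc n) = cong (λ k → 5 + 4 * pair 1 k) (go n)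

opaque
  -- The number of a program specialised to its own number, in arithmetic: 5 and 6 are the tags of
  -- `compC` and `pairC`, and 2 is the number of `idC`.
  self-applyF : Fun
  self-applyF = plusF 5 (quadrupleF ⟨ idF , plusF 6 (quadrupleF ⟨ codeOf-numeralF , numF 2 ⟩) ⟩)

  self-apply-code : ∀ c → ⟦ self-applyF ⟧ (codeOf c) ≡ codeOf (specialise c (codeOf c))
  self-apply-code c = refl

  -- The diagonal program c replaces its first input p by the number of p specialised to p, then
  -- applies f. Specialised to its own number, it hands f exactly the number of the resulting
  -- program.
  kleene : ∀ (f : Fun) → ∃[ e ] (∀ x → φ e x (⟦ f ⟧ (pair e x)))
  kleene f = codeOf (specialise c (codeOf c)) , λ x → specialise c (codeOf c) , refl ,
    eComp (ePair (eval (numF (codeOf c)) x) eId)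
          (subst (Eval c (pair (codeOf c) x)) (cong ⟦ f ⟧ (cong₂ pair
                   (trans (cong ⟦ self-applyF ⟧ (π₁-pair (codeOf c) x)) (self-apply-code c))
                   (π₂-pair (codeOf c) x)))
                 (eval diagonalF (pair (codeOf c) x)))
    where
    diagonalF : Fun
    diagonalF = f ∘F ⟨ self-applyF ∘F fstF idF , sndF idF ⟩
    c : Code
    c = code diagonalF

-- Diagonalisation

encPrefix-cong : ∀ {S T} n → (∀ i → i < n → S i ≡ T i) → encPrefix S n ≡ encPrefix T n
encPrefix-cong zero    eq = refl
encPrefix-cong (suc n) eq = cong₂ (λ p v → suc (pair p (encElem v)))
  (encPrefix-cong n (λ i i<n → eq i (m<n⇒m<1+n i<n))) (eq n ≤-refl)

decElem : ℕ → Maybe ℕ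
decElem zero    = nothing
decElem (suc x) = just x

encElem-decElem : ∀ k → encElem (decElem k) ≡ k
encElem-decElem zero    = refl
encElem-decElem (suc _) = refl

decElem-just : ∀ {k x} → decElem k ≡ just x → k ≡ suc x
decElem-just {suc _} refl = refl

replace : Text → ℕ → Maybe ℕ → Text
replace T n v i with i ≟ n
... | yes _ = v
... | no  _ = T i

replace-same : ∀ T n v → replace T n v n ≡ v
replace-same T n v with n ≟ n
... | yes _   = refl
... | no  n≢n = ⊥-elim (n≢n refl)

replace-below : ∀ T n v i → i < n → T i ≡ replace T n v i
replace-below T n v i i<n with i ≟ n
... | yes refl = ⊥-elim (<-irrefl refl i<n)
... | no  _    = refl

π₁-≤ : ∀ n → π₁ n ≤ n
π₁-≤ n = subst (π₁ n ≤_) (pair-π n)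
  (≤-trans (m≤m+n (π₁ n) (π₂ n)) (≤-trans (n≤tri (π₁ n + π₂ n)) (m≤m+n _ (π₂ n))))
  where
  n≤tri : ∀ n → n ≤ tri n
  n≤tri zero    = z≤n
  n≤tri (suc n) = m≤m+n (suc n) (tri n)

-- Transfers a requirement on all texts to all numerical inputs of a learner; in particular `h` is
-- total.
encPrefix-surjective : ∀ σ → ∃[ T ] ∃[ n ] encPrefix T n ≡ σ
encPrefix-surjective = <-rec _ go
  where
  go : ∀ σ → (∀ {τ} → τ < σ → ∃[ T ] ∃[ n ] encPrefix T n ≡ τ) → ∃[ T ] ∃[ n ] encPrefix T n ≡ σ
  go zero    _  = (λ _ → nothing) , 0 , refl
  go (suc m) ih with ih (s≤s (π₁-≤ m))
  ... | T , n , eq = T′ , suc n , cong suc (trans (cong₂ pair prefix-eq elem-eq) (pair-π m))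
    where
    v = decElem (π₂ m)
    T′ = replace T n v
    prefix-eq : encPrefix T′ n ≡ π₁ m
    prefix-eq = trans (sym (encPrefix-cong n (replace-below T n v))) eq
    elem-eq : encElem (T′ n) ≡ π₂ m
    elem-eq = trans (cong encElem (replace-same T n v)) (encElem-decElem (π₂ m))

-- Nonemptiness guarantees a datum that makes the transductive learner leave `?`.
Marked : Lang → Set
Marked L = ∃[ e ] (CIndex e × SameLang (C e) L × (∃[ x ] L x) × (∀ x → L x → π₁ x ≡ e))

module _ (h : ℕ) (cind : ∀ T → CInd (G h T) T) where

  -- The output 0, which encodes ?, is read as index 0, and the program zeroC decides ∅.
  hypothesis : ∀ σ → ∃[ o ] (φ h σ o × CIndex (pred o))
  hypothesis σ with encPrefix-surjective σ
  ... | T , n , refl with cind T n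
  ... | inj₁ d = 0 , d , λ x → 0 , (zeroC , refl , eZero) , inj₁ refl
  ... | inj₂ (e , d , ci) = suc e , d , ci

  opaque
    -- The values come from the proof that `h` always converges, the program from running `h`
    -- universally.
    outputF : Fun
    outputF = fun (λ σ → proj₁ (hypothesis σ)) (compC universal (pairC (numeral h) idC))
      (λ σ → eComp (ePair (eval (numF h) σ) eId) (φ-universal (proj₁ (proj₂ (hypothesis σ)))))

    output-φ : ∀ {σ o} → φ h σ o → ⟦ outputF ⟧ σ ≡ o
    output-φ {σ} d = φ-functional (proj₁ (proj₂ (hypothesis σ))) d

    guess : ∀ σ x → ∃[ y ] (φ (pred (⟦ outputF ⟧ σ)) x y × (y ≡ 0 ⊎ y ≡ 1))
    guess σ = proj₂ (proj₂ (hypothesis σ))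

    guessF : Fun
    guessF = fun (λ s → proj₁ (guess (π₁ s) (π₂ s)))
      (compC universal (code ⟨ predF (outputF ∘F fstF idF) , sndF idF ⟩))
      (λ s → eComp (eval ⟨ predF (outputF ∘F fstF idF) , sndF idF ⟩ s)
                   (φ-universal (proj₁ (proj₂ (guess (π₁ s) (π₂ s))))))

    guess-correct : ∀ σ x → φ (pred (⟦ outputF ⟧ σ)) x (⟦ guessF ⟧ (pair σ x)) ×
                            (⟦ guessF ⟧ (pair σ x) ≡ 0 ⊎ ⟦ guessF ⟧ (pair σ x) ≡ 1)
    guess-correct σ x rewrite π₁-pair σ x | π₂-pair σ x = proj₂ (guess σ x)

  -- With e = ⟦ eF ⟧ s, n = ⟦ nF ⟧ s and the code σ of T[n], the code of T(n): it is #, encoded by 0,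
  -- exactly when n > 0 and the hypothesis on T[n] contains ⟨e,n⟩.
  elemF : Fun → Fun → Fun → Fun
  elemF eF nF σF = ifzF (ifzF nF zeroF (guessF ∘F ⟨ σF , ⟨ eF , nF ⟩ ⟩)) (sucF ⟨ eF , nF ⟩) zeroF

  elem : ℕ → ℕ → ℕ → ℕ
  elem e n σ = ifz (ifz n 0 (⟦ guessF ⟧ (pair σ (pair e n)))) (suc (pair e n)) 0

  -- The recursion runs on codes of prefixes, since each entry depends on the whole text before it.
  prefix : ℕ → ℕ → ℕ
  prefix e zero    = 0
  prefix e (suc n) = suc (pair (prefix e n) (elem e n (prefix e n)))

  prefixF : Fun → Fun → Fun
  prefixF eF nF = fun (λ s → prefix (⟦ eF ⟧ s) (⟦ nF ⟧ s)) (code (recF nF zeroF extendF))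
    (λ s → subst (Eval _ s) (go s (⟦ nF ⟧ s)) (eval (recF nF zeroF extendF) s))
    where
    extendF : Fun
    extendF = sucF ⟨ sndF (sndF idF) ,
                     elemF (eF ∘F fstF idF) (fstF (sndF idF)) (sndF (sndF idF)) ⟩
    extend-eq : ∀ s n σ → ⟦ extendF ⟧ (pair s (pair n σ)) ≡ suc (pair σ (elem (⟦ eF ⟧ s) n σ))
    extend-eq s n σ rewrite π₁-pair s (pair n σ) | π₂-pair s (pair n σ) | π₁-pair n σ | π₂-pair n σ
      = refl
    go : ∀ s n → rec (λ _ → 0) ⟦ extendF ⟧ s n ≡ prefix (⟦ eF ⟧ s) n
    go s zero    = refl
    go s (suc n) = trans (extend-eq s n _)
      (cong (λ σ → suc (pair σ (elem (⟦ eF ⟧ s) n σ))) (go s n))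

  -- Two vanishing truncated differences express that the first component of x is e; the entry at
  -- position `π₂ x` then settles membership.
  decide : ℕ → ℕ → ℕ
  decide e x = ifz (π₁ x ∸ e) (ifz (e ∸ π₁ x) (ifz (elem e (π₂ x) (prefix e (π₂ x))) 0 1) 0) 0

  opaque
    deciderF : Fun
    deciderF = ifzF (monusF (fstF xF) eF) (ifzF (monusF eF (fstF xF)) elementF zeroF) zeroF
      where
      eF xF elementF : Fun
      eF = fstF idF
      xF = sndF idF
      elementF = ifzF (elemF eF (sndF xF) (prefixF eF (sndF xF))) zeroF (numF 1)

    decider-eq : ∀ e x → ⟦ deciderF ⟧ (pair e x) ≡ decide e x
    decider-eq e x rewrite π₁-pair e x | π₂-pair e x = refl

  self-deciding : ∃[ e ] (∀ x → φ e x (decide e x))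
  self-deciding = e , λ x → subst (φ e x) (decider-eq e x) (proj₂ (kleene deciderF) x)
    where
    e : ℕ
    e = proj₁ (kleene deciderF)

  decide-01 : ∀ e x → decide e x ≡ 0 ⊎ decide e x ≡ 1
  decide-01 e x with π₁ x ∸ e | e ∸ π₁ x | elem e (π₂ x) (prefix e (π₂ x))
  ... | suc _ | _     | _     = inj₁ refl
  ... | zero  | suc _ | _     = inj₁ refl
  ... | zero  | zero  | zero  = inj₁ refl
  ... | zero  | zero  | suc _ = inj₂ refl

  decide-intro : ∀ e n k → elem e n (prefix e n) ≡ suc k → decide e (pair e n) ≡ 1
  decide-intro e n k eq rewrite π₁-pair e n | π₂-pair e n | n∸n≡0 e | eq = refl

  decide-elim : ∀ e x → decide e x ≡ 1 →
                π₁ x ≡ e × (∃[ k ] elem e (π₂ x) (prefix e (π₂ x)) ≡ suc k)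
  decide-elim e x eq
    with π₁ x ∸ e in le | e ∸ π₁ x in ge | elem e (π₂ x) (prefix e (π₂ x))
  ... | zero | zero | suc k =
    ≤-antisym (m∸n≡0⇒m≤n le) (m∸n≡0⇒m≤n ge) , k , refl

  elem-suc : ∀ e n σ {k} → elem e n σ ≡ suc k → k ≡ pair e n
  elem-suc e n σ eq with ifz n 0 (⟦ guessF ⟧ (pair σ (pair e n)))
  elem-suc e n σ refl | zero = refl

  text : ℕ → Text
  text e n = decElem (elem e n (prefix e n))

  encPrefix-text : ∀ e n → encPrefix (text e) n ≡ prefix e n
  encPrefix-text e zero    = refl
  encPrefix-text e (suc n) = cong suc (cong₂ pair (encPrefix-text e n) (encElem-decElem _))

  text-just : ∀ e n {x} → text e n ≡ just x → x ≡ pair e n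
  text-just e n eq = elem-suc e n (prefix e n) (decElem-just eq)

  -- Failure of the learner on the diagonal text

  module _ (e : ℕ) (e-decides : ∀ x → φ e x (decide e x)) where

    e-CIndex : CIndex e
    e-CIndex x = decide e x , e-decides x , decide-01 e x

    content-text : SameLang (C e) (content (text e))
    content-text x = mk⇔ fwd bwd
      where
      fwd : C e x → content (text e) x
      fwd c with decide-elim e x (φ-functional (e-decides x) c)
      ... | mark , k , eq = π₂ x , trans (cong decElem eq) (cong just
        (trans (elem-suc e (π₂ x) (prefix e (π₂ x)) eq)
               (trans (cong (λ m → pair m (π₂ x)) (sym mark)) (pair-π x))))
      bwd : content (text e) x → C e x
      bwd (n , eq) = subst (C e) (sym (text-just e n eq))
        (subst (φ e (pair e n)) (decide-intro e n x (decElem-just eq)) (e-decides (pair e n)))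

    marked : Marked (C e)
    marked = e , e-CIndex , (λ x → mk⇔ (λ c → c) (λ c → c)) ,
      -- Entry 0 consults no hypothesis, so it is ⟨e,0⟩ unconditionally.
      (pair e 0 , from (content-text (pair e 0)) (0 , refl)) ,
      λ x c → proj₁ (decide-elim e x (φ-functional (e-decides x) c))

    ¬Bc : ¬ Bc-C (G h (text e)) (text e)
    -- The successor ensures a positive position, where the entry depends on the hypothesis.
    ¬Bc (n₀ , stable) with stable (suc n₀) (n≤1+n n₀)
    ... | e′ , output , _ , same = contradiction
      where
      n x σ : ℕ
      n = suc n₀
      x = pair e n
      σ = prefix e n

      hyp : ⟦ outputF ⟧ σ ≡ suc e′
      hyp = output-φ (subst (λ p → φ h p (suc e′)) (encPrefix-text e n) output)

      guessed : φ e′ x (⟦ guessF ⟧ (pair σ x))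
      guessed = subst (λ o → φ (pred o) x (⟦ guessF ⟧ (pair σ x))) hyp (proj₁ (guess-correct σ x))

      text-n : ∀ b → ⟦ guessF ⟧ (pair σ x) ≡ b → text e n ≡ decElem (ifz b (suc x) 0)
      text-n b eq = cong (λ b → decElem (ifz b (suc x) 0)) eq

      contradiction : ⊥
      contradiction with proj₂ (guess-correct σ x)
      -- The hypothesis rejects x, so the text presents x at n.
      ... | inj₁ eq with () ← φ-functional (subst (φ e′ x) eq guessed)
                                          (from (same x) (n , text-n 0 eq))
      -- The hypothesis accepts x, so x must occur in the text; it could only do so at n, where
      -- there is a pause.
      ... | inj₂ eq with to (same x) (subst (φ e′ x) eq guessed)
      ... | m , at-m with proj₂ (pair-injective e n e m (text-just e m at-m))
      ... | refl with () ← trans (sym (text-n 1 eq)) at-m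

  not-learned : ¬ (∀ L → Marked L → ∀ T → TextFor T L → Bc-C (G h T) T)
  not-learned learns with self-deciding
  ... | e , e-decides = ¬Bc e e-decides (learns (C e) (marked e e-decides) (text e) λ x →
          mk⇔ (from (content-text e e-decides x)) (to (content-text e e-decides x)))

-- The transductive learner

opaque
  learnerF : Fun
  learnerF = ifzF idF zeroF (sucF (fstF (predF idF)))

  learner-index : ∃[ h ] (∀ n → φ h n (ifz n 0 (suc (π₁ (pred n)))))
  learner-index = index learnerF

learner : ℕ
learner = proj₁ learner-index

learner-φ : ∀ n → φ learner n (ifz n 0 (suc (π₁ (pred n))))
learner-φ = proj₂ learner-index

module _ {L : Lang} {e : ℕ} (mark : ∀ x → L x → π₁ x ≡ e) {T : Text} (T-L : TextFor T L) where

  hypotheses : HypSeq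
  hypotheses = Td learner T

  after-element : ∀ {n x} → T n ≡ just x → hypotheses (suc n) (just e)
  after-element {n} {x} eq = tdH (subst₂ (φ learner) (cong encElem (sym eq))
    (cong suc (mark x (to (T-L x) (n , eq)))) (learner-φ (suc x)))

  after-pause : ∀ {n v} → T n ≡ nothing → hypotheses n v → hypotheses (suc n) v
  after-pause eq d = tdQ d (subst (λ k → φ learner k 0) (cong encElem (sym eq)) (learner-φ 0))

  hypothesis-?-or-e : ∀ n → hypotheses n nothing ⊎ hypotheses n (just e)
  hypothesis-?-or-e zero = inj₁ td0
  hypothesis-?-or-e (suc n) with T n in eq | hypothesis-?-or-e n
  ... | just _  | _      = inj₂ (after-element eq)
  ... | nothing | inj₁ d = inj₁ (after-pause eq d)
  ... | nothing | inj₂ d = inj₂ (after-pause eq d)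

  hypothesis-kept : ∀ {m n} → m ≤′ n → hypotheses m (just e) → hypotheses n (just e)
  hypothesis-kept ≤′-refl d = d
  hypothesis-kept (≤′-step {n} m≤n) d with T n in eq
  ... | just _  = after-element eq
  ... | nothing = after-pause eq (hypothesis-kept m≤n d)

Td-learnable : RTxtTdCIndExC Marked
Td-learnable = learner , (λ x → _ , learner-φ x) , learns
  where
  learns : ∀ L → Marked L → ∀ T → TextFor T L → CInd (Td learner T) T × Ex-C (Td learner T) T
  learns L (e , e-CIndex , same , (x , x∈L) , mark) T T-L = cind , ex
    where
    cind : CInd (Td learner T) T
    cind n with hypothesis-?-or-e mark T-L n
    ... | inj₁ d = inj₁ d
    ... | inj₂ d = inj₂ (e , d , e-CIndex)
    ex : Ex-C (Td learner T) T
    ex with from (T-L x) x∈L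
    -- The datum at position n first shows in hypothesis n + 1.
    ... | n , eq = suc n , e ,
      (λ k n<k → hypothesis-kept mark T-L (≤⇒≤′ n<k) (after-element mark T-L eq)) ,
      e-CIndex ,
      λ y → mk⇔ (λ c → from (T-L y) (to (same y) c)) (λ t → from (same y) (to (T-L y) t))

theorem10 : Σ (Lang → Set) (λ 𝓛 → (∀ L → 𝓛 L → REC L) × RTxtTdCIndExC 𝓛 × ¬ τCIndTxtGBcC 𝓛)
theorem10 =
  Marked ,
  (λ { L (e , e-CIndex , same , _) → e , e-CIndex , same }) ,
  Td-learnable ,
  λ { (h , cind , learns) → not-learned h cind learns }
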